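{- For every prime power $q$ and every integer $v>1$, $$N_{v,v}(q)=(q-1)\sum_{0\le u<v}N_{v,u}(q).$$
   Context: Let $q$ be a prime power, $\mathbb{F}_q$ the field with $q$ elements and $\mathcal{P}^1(\mathbb{F}_q)=\mathbb{F}_q\cup\{\infty\}$. Let $V,U$ be nonzero polynomials over $\mathbb{F}_q$ with $\gcd(V,U)=1$, of degrees $v,u$ and leading coefficients $a_v,b_u$. The rational function $V(x)/U(x)$ is evaluated on $\mathcal{P}^1(\mathbb{F}_q)$ as follows: at $a\in\mathbb{F}_q$ its value is $V(a)/U(a)$, understood as $\infty$ if $U(a)=0$; at $\infty$ its value is $\infty$ if $v>u$, $0$ if $v<u$, and $a_v/b_v$ if $v=u$. It is a permutation rational function (PRF) if it permutes $\mathcal{P}^1(\mathbb{F}_q)$. $P_{v,u}(q)$ is the set of PRFs $V(x)/U(x)$ (as rational functions, so $V/U$ and $(cV)/(cU)$ with $c\in\mathbb{F}_q\setminus\{0\}$ are the same element) with $\deg V=v$ and $\deg U=u$, and $N_{v,u}(q)=|P_{v,u}(q)|$. -}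

module Defs where

open import Level using (Level; _⊔_) renaming (suc to lsuc)
open import Algebra.Bundles using (CommutativeRing; AbelianGroup)
open import Algebra.Definitions using (Invertible)
import Algebra.Properties.CommutativeSemigroup as CommutativeSemigroupProperties
import Algebra.Properties.Ring as RingProperties
import Algebra.Properties.Semiring.Divisibility as Divisibility
import Algebra.Properties.Semiring.Primality as Primality
open import Data.Empty using (⊥-elim)
open import Data.Fin.Base using (Fin; zero; suc)
import Data.Fin.Properties as Fin
open import Data.List.Base
  using (List; []; _∷_; map; drop; lookup; length; allFin; cartesianProductWith; cartesianProduct; deduplicate)
open import Data.List.Membership.Propositional.Properties using (∈-allFin; ∈-lookup)
open import Data.List.Relation.Unary.Any as Any using (Any; here; there)
import Data.List.Relation.Unary.Any.Properties as Any
open import Data.List.Relation.Unary.All as All using (All)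
open import Data.List.Relation.Unary.AllPairs using (_∷_)
open import Data.List.Relation.Unary.Enumerates.Setoid using (IsEnumeration)
import Data.List.Relation.Unary.Enumerates.Setoid.Properties as Enumerates
open import Data.List.Relation.Unary.Unique.DecSetoid.Properties using (deduplicate-!)
open import Data.List.Relation.Unary.Unique.Setoid using (Unique)
open import Data.Maybe.Base using (Maybe; just; nothing)
import Data.Maybe.Relation.Binary.Pointwise as Maybe
open import Data.Nat.Base as ℕ using (ℕ; zero; suc)
open import Data.Nat.Primality using (Prime)
import Data.Nat.Properties as ℕ
open import Data.Product.Base using (∃; ∃₂; _×_; _,_; proj₁; proj₂)
open import Data.Sum.Base using (_⊎_; inj₁; inj₂)
open import Function.Base using (_∘_)
open import Function.Bundles using (Inverse)
open import Function.Definitions using (Bijective)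
open import Function.Properties.Inverse using (Inverse⇒Injection)
open import Relation.Binary.Bundles using (Setoid)
open import Relation.Binary.Definitions using (Decidable; tri<; tri≈; tri>)
open import Relation.Binary.PropositionalEquality as ≡ using (_≡_)
import Relation.Binary.Reasoning.Setoid as SetoidReasoning
open import Relation.Nullary using (¬_; Dec; yes; no)
open import Relation.Nullary.Decidable using (map′; _×-dec_; _→-dec_; ¬?; via-injection)

private
  variable
    a c ℓ p : Level

_HasCardinality_ : Setoid a ℓ → ℕ → Set (a ⊔ ℓ)
S HasCardinality n = Inverse S (≡.setoid (Fin n))

PrimePower : ℕ → Set
PrimePower q = ∃₂ λ p k → Prime p × 1 ℕ.≤ k × q ≡ p ℕ.^ k

record FiniteField c ℓ (q : ℕ) : Set (lsuc (c ⊔ ℓ)) where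
  field
    commutativeRing : CommutativeRing c ℓ

  open CommutativeRing commutativeRing public

  field
    1≉0            : 1# ≉ 0#
    ≉0⇒invertible  : ∀ {x} → x ≉ 0# → Invertible _≈_ 1# _*_ x
    hasCardinality : setoid HasCardinality q

module FiniteSetoid (S : Setoid a ℓ) where
  open Setoid S renaming (Carrier to A)

  enumeration : ∀ {n} → S HasCardinality n → ∃ (IsEnumeration S)
  enumeration {n} card = map from (allFin n) , λ x →
    Any.map⁺ (Any.map (λ { ≡.refl → sym (strictlyInverseʳ x) }) (∈-allFin (to x)))
    where open Inverse card

  private
    lookup-injective : ∀ {xs} → Unique S xs → ∀ i j →
                       lookup xs i ≈ lookup xs j → i ≡ j
    lookup-injective (x∉ ∷ u) zero    zero    _ = ≡.refl
    lookup-injective (x∉ ∷ u) zero    (suc j) e = ⊥-elim (All.lookup x∉ (∈-lookup j) e)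
    lookup-injective (x∉ ∷ u) (suc i) zero    e = ⊥-elim (All.lookup x∉ (∈-lookup i) (sym e))
    lookup-injective (x∉ ∷ u) (suc i) (suc j) e = ≡.cong suc (lookup-injective u i j e)

  enumeration⇒finite : ∀ {xs} → Decidable _≈_ → IsEnumeration S xs → ∃ (S HasCardinality_)
  enumeration⇒finite {xs} _≟_ ∈xs = length ys , record
    { to        = index
    ; from      = lookup ys
    ; to-cong   = index-cong
    ; from-cong = λ { ≡.refl → refl }
    ; inverse   = (λ {i} e → lookup-injective unique _ i
                              (trans (sym (lookup-index _)) e))
                , (λ { ≡.refl → sym (lookup-index _) })
    }
    where
    D = record { isDecEquivalence = record { isEquivalence = isEquivalence ; _≟_ = _≟_ } }
    ys = deduplicate _≟_ xs
    ∈ys = Enumerates.deduplicate⁺ D ∈xs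
    unique = deduplicate-! D xs
    index = λ x → Any.index (∈ys x)
    lookup-index : ∀ x → x ≈ lookup ys (index x)
    lookup-index x = Any.lookup-index (∈ys x)
    index-cong : ∀ {x y} → x ≈ y → index x ≡ index y
    index-cong x≈y = lookup-injective unique _ _
      (trans (sym (lookup-index _)) (trans x≈y (lookup-index _)))

  module _ {xs} (∈xs : IsEnumeration S xs) {P : A → Set p}
           (resp : ∀ {x y} → x ≈ y → P x → P y) (P? : ∀ x → Dec (P x)) where

    ∀? : Dec (∀ x → P x)
    ∀? = map′ (λ ps x → All.lookupWith (λ py x≈y → resp (sym x≈y) py) ps (∈xs x))
              (λ f → All.universal f xs) (All.all? P? xs)

    ∃? : Dec (∃ P)
    ∃? = map′ Any.satisfied (λ (x , px) → Any.map (λ e → resp e px) (∈xs x))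
              (Any.any? P? xs)

module Polynomials (R : CommutativeRing c ℓ) where
  open CommutativeRing R hiding (setoid; isEquivalence)
  private
    module R = CommutativeRing R
    module RP = RingProperties ring
    module +S = CommutativeSemigroupProperties +-commutativeSemigroup

  infix  8 -ₚ_
  infixl 7 _*ₚ_ _·_
  infixl 6 _+ₚ_
  infix  4 _≈ₚ_

  -- Coefficients in order of increasing degree; trailing zeros are allowed,
  -- and are made irrelevant by _≈ₚ_.
  Poly : Set c
  Poly = List Carrier

  coeff : Poly → ℕ → Carrier
  coeff []      _       = 0#
  coeff (x ∷ p) zero    = x
  coeff (x ∷ p) (suc i) = coeff p i

  record _≈ₚ_ (p q : Poly) : Set ℓ where
    constructor eq
    field coeff-≈ : ∀ i → coeff p i ≈ coeff q i
  open _≈ₚ_ public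

  _+ₚ_ : Poly → Poly → Poly
  []      +ₚ q       = q
  (x ∷ p) +ₚ []      = x ∷ p
  (x ∷ p) +ₚ (y ∷ q) = x + y ∷ p +ₚ q

  -ₚ_ : Poly → Poly
  -ₚ_ = map (λ x → - x)

  _·_ : Carrier → Poly → Poly
  x · p = map (x *_) p

  _*ₚ_ : Poly → Poly → Poly
  []      *ₚ q = []
  (x ∷ p) *ₚ q = x · q +ₚ (0# ∷ p *ₚ q)

  0ₚ 1ₚ : Poly
  0ₚ = []
  1ₚ = 1# ∷ []

  eval : Poly → Carrier → Carrier
  eval []      x = 0#
  eval (y ∷ p) x = y + x * eval p x

  record HasDegree (p : Poly) (d : ℕ) : Set ℓ where
    constructor _,_
    field
      leading≉0 : coeff p d ≉ 0#
      above≈0   : ∀ i → d ℕ.< i → coeff p i ≈ 0#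
  open HasDegree public

  reflₚ : ∀ {p} → p ≈ₚ p
  reflₚ = eq λ i → refl

  symₚ : ∀ {p q} → p ≈ₚ q → q ≈ₚ p
  symₚ (eq e) = eq λ i → sym (e i)

  transₚ : ∀ {p q r} → p ≈ₚ q → q ≈ₚ r → p ≈ₚ r
  transₚ (eq e) (eq f) = eq λ i → trans (e i) (f i)

  setoidₚ : Setoid c ℓ
  setoidₚ = record
    { _≈_           = _≈ₚ_
    ; isEquivalence = record { refl = reflₚ ; sym = symₚ ; trans = transₚ }
    }

  ∷-cong : ∀ {x y p q} → x ≈ y → p ≈ₚ q → (x ∷ p) ≈ₚ (y ∷ q)
  ∷-cong e (eq f) = eq λ { zero → e ; (suc i) → f i }

  tail-cong : ∀ {x y p q} → (x ∷ p) ≈ₚ (y ∷ q) → p ≈ₚ q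
  tail-cong (eq e) = eq (e ∘ suc)

  coeff-+ : ∀ p q i → coeff (p +ₚ q) i ≈ coeff p i + coeff q i
  coeff-+ []      q       i       = sym (+-identityˡ _)
  coeff-+ (x ∷ p) []      i       = sym (+-identityʳ _)
  coeff-+ (x ∷ p) (y ∷ q) zero    = refl
  coeff-+ (x ∷ p) (y ∷ q) (suc i) = coeff-+ p q i

  coeff-- : ∀ p i → coeff (-ₚ p) i ≈ - coeff p i
  coeff-- []      i       = sym RP.-0#≈0#
  coeff-- (x ∷ p) zero    = refl
  coeff-- (x ∷ p) (suc i) = coeff-- p i

  coeff-· : ∀ x p i → coeff (x · p) i ≈ x * coeff p i
  coeff-· x []      i       = sym (zeroʳ x)
  coeff-· x (y ∷ p) zero    = refl
  coeff-· x (y ∷ p) (suc i) = coeff-· x p i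

  +ₚ-cong : ∀ {p q r s} → p ≈ₚ q → r ≈ₚ s → p +ₚ r ≈ₚ q +ₚ s
  +ₚ-cong {p} {q} {r} {s} (eq e) (eq f) = eq λ i →
    trans (coeff-+ p r i) (trans (+-cong (e i) (f i)) (sym (coeff-+ q s i)))

  -ₚ-cong : ∀ {p q} → p ≈ₚ q → -ₚ p ≈ₚ -ₚ q
  -ₚ-cong {p} {q} (eq e) = eq λ i →
    trans (coeff-- p i) (trans (-‿cong (e i)) (sym (coeff-- q i)))

  ·-cong : ∀ {x y p q} → x ≈ y → p ≈ₚ q → x · p ≈ₚ y · q
  ·-cong {x} {y} {p} {q} e (eq f) = eq λ i →
    trans (coeff-· x p i) (trans (*-cong e (f i)) (sym (coeff-· y q i)))

  +ₚ-assoc : ∀ p q r → (p +ₚ q) +ₚ r ≈ₚ p +ₚ (q +ₚ r)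
  +ₚ-assoc p q r = eq λ i → begin
    coeff ((p +ₚ q) +ₚ r) i             ≈⟨ coeff-+ (p +ₚ q) r i ⟩
    coeff (p +ₚ q) i + coeff r i        ≈⟨ +-congʳ (coeff-+ p q i) ⟩
    coeff p i + coeff q i + coeff r i   ≈⟨ +-assoc _ _ _ ⟩
    coeff p i + (coeff q i + coeff r i) ≈⟨ +-congˡ (coeff-+ q r i) ⟨
    coeff p i + coeff (q +ₚ r) i        ≈⟨ coeff-+ p (q +ₚ r) i ⟨
    coeff (p +ₚ (q +ₚ r)) i             ∎
    where open SetoidReasoning R.setoid

  +ₚ-comm : ∀ p q → p +ₚ q ≈ₚ q +ₚ p
  +ₚ-comm p q = eq λ i →
    trans (coeff-+ p q i) (trans (+-comm _ _) (sym (coeff-+ q p i)))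

  +ₚ-identityʳ : ∀ p → p +ₚ 0ₚ ≈ₚ p
  +ₚ-identityʳ p = +ₚ-comm p 0ₚ

  -ₚ-inverseʳ : ∀ p → p +ₚ -ₚ p ≈ₚ 0ₚ
  -ₚ-inverseʳ p = eq λ i →
    trans (coeff-+ p (-ₚ p) i) (trans (+-congˡ (coeff-- p i)) (-‿inverseʳ _))

  +ₚ-abelianGroup : AbelianGroup c ℓ
  +ₚ-abelianGroup = record
    { _∙_ = _+ₚ_ ; ε = 0ₚ ; _⁻¹ = -ₚ_
    ; isAbelianGroup = record
      { isGroup = record
        { isMonoid = record
          { isSemigroup = record
            { isMagma = record { isEquivalence = Setoid.isEquivalence setoidₚ ; ∙-cong = +ₚ-cong }
            ; assoc = +ₚ-assoc
            }
          ; identity = (λ _ → reflₚ) , +ₚ-identityʳ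
          }
        ; inverse = (λ p → transₚ (+ₚ-comm (-ₚ p) p) (-ₚ-inverseʳ p)) , -ₚ-inverseʳ
        ; ⁻¹-cong = -ₚ-cong
        }
      ; comm = +ₚ-comm
      }
    }

  private
    module +ₚ = CommutativeSemigroupProperties (AbelianGroup.commutativeSemigroup +ₚ-abelianGroup)
    open SetoidReasoning setoidₚ

  ·-distribˡ : ∀ x p q → x · (p +ₚ q) ≈ₚ x · p +ₚ x · q
  ·-distribˡ x []      q       = reflₚ
  ·-distribˡ x (y ∷ p) []      = reflₚ
  ·-distribˡ x (y ∷ p) (z ∷ q) = ∷-cong (distribˡ x y z) (·-distribˡ x p q)

  ·-assoc : ∀ x y p → (x * y) · p ≈ₚ x · (y · p)
  ·-assoc x y []      = reflₚ
  ·-assoc x y (z ∷ p) = ∷-cong (*-assoc x y z) (·-assoc x y p)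

  ·-identity : ∀ p → 1# · p ≈ₚ p
  ·-identity []      = reflₚ
  ·-identity (x ∷ p) = ∷-cong (*-identityˡ x) (·-identity p)

  0∷[] : (0# ∷ []) ≈ₚ 0ₚ
  0∷[] = eq λ { zero → refl ; (suc i) → refl }

  ·-zero : ∀ p → 0# · p ≈ₚ 0ₚ
  ·-zero p = eq λ i → trans (coeff-· 0# p i) (zeroˡ _)

  *ₚ-congˡ : ∀ p {q r} → q ≈ₚ r → p *ₚ q ≈ₚ p *ₚ r
  *ₚ-congˡ []      e = reflₚ
  *ₚ-congˡ (x ∷ p) e = +ₚ-cong (·-cong refl e) (∷-cong refl (*ₚ-congˡ p e))

  *ₚ-zeroʳ : ∀ p → p *ₚ 0ₚ ≈ₚ 0ₚ
  *ₚ-zeroʳ []      = reflₚ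
  *ₚ-zeroʳ (x ∷ p) = transₚ (∷-cong refl (*ₚ-zeroʳ p)) 0∷[]

  *ₚ-∷ʳ : ∀ p y q → p *ₚ (y ∷ q) ≈ₚ y · p +ₚ (0# ∷ p *ₚ q)
  *ₚ-∷ʳ []      y q = symₚ 0∷[]
  *ₚ-∷ʳ (x ∷ p) y q = ∷-cong (+-congʳ (*-comm x y)) (begin
    x · q +ₚ p *ₚ (y ∷ q)                ≈⟨ +ₚ-cong (reflₚ {x · q}) (*ₚ-∷ʳ p y q) ⟩
    x · q +ₚ (y · p +ₚ (0# ∷ p *ₚ q))    ≈⟨ +ₚ.x∙yz≈y∙xz (x · q) (y · p) _ ⟩
    y · p +ₚ (x · q +ₚ (0# ∷ p *ₚ q))    ∎)

  *ₚ-comm : ∀ p q → p *ₚ q ≈ₚ q *ₚ p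
  *ₚ-comm []      q = symₚ (*ₚ-zeroʳ q)
  *ₚ-comm (x ∷ p) q = begin
    x · q +ₚ (0# ∷ p *ₚ q) ≈⟨ +ₚ-cong (reflₚ {x · q}) (∷-cong refl (*ₚ-comm p q)) ⟩
    x · q +ₚ (0# ∷ q *ₚ p) ≈⟨ *ₚ-∷ʳ q x p ⟨
    q *ₚ (x ∷ p)           ∎

  *ₚ-cong : ∀ {p q r s} → p ≈ₚ q → r ≈ₚ s → p *ₚ r ≈ₚ q *ₚ s
  *ₚ-cong {p} {q} {r} {s} e f = begin
    p *ₚ r ≈⟨ *ₚ-congˡ p f ⟩
    p *ₚ s ≈⟨ *ₚ-comm p s ⟩
    s *ₚ p ≈⟨ *ₚ-congˡ s e ⟩
    s *ₚ q ≈⟨ *ₚ-comm s q ⟩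
    q *ₚ s ∎

  *ₚ-distribˡ : ∀ p q r → p *ₚ (q +ₚ r) ≈ₚ p *ₚ q +ₚ p *ₚ r
  *ₚ-distribˡ []      q r = reflₚ
  *ₚ-distribˡ (x ∷ p) q r = begin
    x · (q +ₚ r) +ₚ (0# ∷ p *ₚ (q +ₚ r))
      ≈⟨ +ₚ-cong (·-distribˡ x q r) (∷-cong (sym (+-identityˡ 0#)) (*ₚ-distribˡ p q r)) ⟩
    (x · q +ₚ x · r) +ₚ ((0# ∷ p *ₚ q) +ₚ (0# ∷ p *ₚ r))
      ≈⟨ +ₚ.interchange (x · q) (x · r) _ _ ⟩
    (x · q +ₚ (0# ∷ p *ₚ q)) +ₚ (x · r +ₚ (0# ∷ p *ₚ r)) ∎

  *ₚ-distribʳ : ∀ p q r → (q +ₚ r) *ₚ p ≈ₚ q *ₚ p +ₚ r *ₚ p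
  *ₚ-distribʳ p q r = begin
    (q +ₚ r) *ₚ p      ≈⟨ *ₚ-comm (q +ₚ r) p ⟩
    p *ₚ (q +ₚ r)      ≈⟨ *ₚ-distribˡ p q r ⟩
    p *ₚ q +ₚ p *ₚ r   ≈⟨ +ₚ-cong (*ₚ-comm p q) (*ₚ-comm p r) ⟩
    q *ₚ p +ₚ r *ₚ p   ∎

  ·-*ₚ : ∀ x p q → (x · p) *ₚ q ≈ₚ x · (p *ₚ q)
  ·-*ₚ x []      q = reflₚ
  ·-*ₚ x (y ∷ p) q = begin
    (x * y) · q +ₚ (0# ∷ (x · p) *ₚ q)
      ≈⟨ +ₚ-cong (·-assoc x y q) (∷-cong (sym (zeroʳ x)) (·-*ₚ x p q)) ⟩
    x · (y · q) +ₚ x · (0# ∷ p *ₚ q)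
      ≈⟨ ·-distribˡ x (y · q) _ ⟨
    x · (y · q +ₚ (0# ∷ p *ₚ q)) ∎

  *ₚ-assoc : ∀ p q r → (p *ₚ q) *ₚ r ≈ₚ p *ₚ (q *ₚ r)
  *ₚ-assoc []      q r = reflₚ
  *ₚ-assoc (x ∷ p) q r = begin
    (x · q +ₚ (0# ∷ p *ₚ q)) *ₚ r
      ≈⟨ *ₚ-distribʳ r (x · q) _ ⟩
    (x · q) *ₚ r +ₚ (0# · r +ₚ (0# ∷ (p *ₚ q) *ₚ r))
      ≈⟨ +ₚ-cong (·-*ₚ x q r) (+ₚ-cong (·-zero r) (∷-cong refl (*ₚ-assoc p q r))) ⟩
    x · (q *ₚ r) +ₚ (0# ∷ p *ₚ (q *ₚ r)) ∎

  *ₚ-identityˡ : ∀ p → 1ₚ *ₚ p ≈ₚ p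
  *ₚ-identityˡ p = begin
    1# · p +ₚ (0# ∷ []) ≈⟨ +ₚ-cong (·-identity p) 0∷[] ⟩
    p +ₚ 0ₚ             ≈⟨ +ₚ-identityʳ p ⟩
    p                   ∎

  polyRing : CommutativeRing c ℓ
  polyRing = record
    { _+_ = _+ₚ_ ; _*_ = _*ₚ_ ; -_ = -ₚ_ ; 0# = 0ₚ ; 1# = 1ₚ
    ; isCommutativeRing = record
      { isRing = record
        { +-isAbelianGroup = AbelianGroup.isAbelianGroup +ₚ-abelianGroup
        ; *-cong           = *ₚ-cong
        ; *-assoc          = *ₚ-assoc
        ; *-identity       = *ₚ-identityˡ , λ p → transₚ (*ₚ-comm p 1ₚ) (*ₚ-identityˡ p)
        ; distrib          = *ₚ-distribˡ , *ₚ-distribʳ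
        }
      ; *-comm = *ₚ-comm
      }
    }

  open Divisibility (CommutativeRing.semiring polyRing) public
    using (_,_) renaming (_∣_ to _∣ₚ_; ∣-respˡ to ∣ₚ-respˡ)
  open Primality (CommutativeRing.semiring polyRing) public
    using () renaming (Coprime to Coprimeₚ)

  eval-cong : ∀ {p q x y} → p ≈ₚ q → x ≈ y → eval p x ≈ eval q y
  eval-cong {p} {q} e x≈y = trans (go p q e) (argument q)
    where
    vanish : ∀ p {x} → p ≈ₚ 0ₚ → eval p x ≈ 0#
    vanish []      e = refl
    vanish (z ∷ p) e = trans (+-cong (coeff-≈ e 0) (*-congˡ (vanish p (eq (coeff-≈ e ∘ suc)))))
                             (trans (+-identityˡ _) (zeroʳ _))
    go : ∀ p q {x} → p ≈ₚ q → eval p x ≈ eval q x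
    go []      q       e = sym (vanish q (symₚ e))
    go (z ∷ p) []      e = vanish (z ∷ p) e
    go (z ∷ p) (w ∷ q) e = +-cong (coeff-≈ e 0) (*-congˡ (go p q (tail-cong e)))
    argument : ∀ q → eval q _ ≈ eval q _
    argument []      = refl
    argument (w ∷ q) = +-congˡ (*-cong x≈y (argument q))

  HasDegree-cong : ∀ {p q d} → p ≈ₚ q → HasDegree p d → HasDegree q d
  HasDegree-cong (eq e) (p≉0 , z) =
    (λ q≈0 → p≉0 (trans (e _) q≈0)) , λ i d<i → trans (sym (e i)) (z i d<i)

  Coprimeₚ-cong : ∀ {p q r s} → p ≈ₚ q → r ≈ₚ s → Coprimeₚ p r → Coprimeₚ q s
  Coprimeₚ-cong e f coprime (m , me) (n , ne) =
    coprime (m , transₚ me (symₚ e)) (n , transₚ ne (symₚ f))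

module RationalFunctions {q} (F : FiniteField c ℓ q) where
  open FiniteField F
  open Polynomials commutativeRing public
  private module F = FiniteSetoid setoid

  infix  4 _≟_
  infixl 7 _÷_

  _≟_ : Decidable _≈_
  _≟_ = via-injection (Inverse⇒Injection hasCardinality) Fin._≟_

  P¹ : Setoid c (c ⊔ ℓ)
  P¹ = Maybe.setoid setoid

  open Setoid P¹ public using () renaming (Carrier to ℙ¹; _≈_ to _≈¹_)

  pattern ∞ = nothing

  _÷_ : Carrier → Carrier → ℙ¹
  x ÷ y with y ≟ 0#
  ... | yes _  = ∞
  ... | no y≉0 = just (x * proj₁ (≉0⇒invertible y≉0))

  -- v and u stand for the degrees of V and U; they only matter at ∞. The
  -- quotient of leading coefficients there is finite, as coeff U u ≉ 0#.
  value : (v u : ℕ) (V U : Poly) → ℙ¹ → ℙ¹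
  value v u V U (just x) = eval V x ÷ eval U x
  value v u V U ∞ with ℕ.<-cmp v u
  ... | tri< _ _ _ = just 0#
  ... | tri≈ _ _ _ = coeff V v ÷ coeff U u
  ... | tri> _ _ _ = ∞

  record IsPRF (v u : ℕ) (V U : Poly) : Set (c ⊔ ℓ) where
    field
      degreeⁿ  : HasDegree V v
      degreeᵈ  : HasDegree U u
      coprime  : Coprimeₚ V U
      permutes : Bijective _≈¹_ _≈¹_ (value v u V U)

  record PRF (v u : ℕ) : Set (c ⊔ ℓ) where
    field
      numerator   : Poly
      denominator : Poly
      isPRF       : IsPRF v u numerator denominator
    open IsPRF isPRF public
  open PRF

  infix 4 _≈ᶠ_

  -- Equality in the field of fractions of the polynomial ring.
  _≈ᶠ_ : ∀ {v u} → PRF v u → PRF v u → Set ℓ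
  f ≈ᶠ g = numerator f *ₚ denominator g ≈ₚ numerator g *ₚ denominator f

  private
    module PR = RingProperties (CommutativeRing.ring polyRing)
    module *ₚ = CommutativeSemigroupProperties (CommutativeRing.*-commutativeSemigroup polyRing)

  integral : ∀ {x y} → x ≉ 0# → y ≉ 0# → x * y ≉ 0#
  integral {x} {y} x≉0 y≉0 xy≈0 = y≉0 (begin
    y              ≈⟨ *-identityˡ y ⟨
    1# * y         ≈⟨ *-congʳ (proj₁ (proj₂ x-inv)) ⟨
    x⁻¹ * x * y    ≈⟨ *-assoc x⁻¹ x y ⟩
    x⁻¹ * (x * y)  ≈⟨ *-congˡ xy≈0 ⟩
    x⁻¹ * 0#       ≈⟨ zeroʳ x⁻¹ ⟩
    0#             ∎)
    where
    open SetoidReasoning setoid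
    x-inv = ≉0⇒invertible x≉0
    x⁻¹ = proj₁ x-inv

  degree? : ∀ p → p ≈ₚ 0ₚ ⊎ ∃ (HasDegree p)
  degree? []      = inj₁ reflₚ
  degree? (x ∷ p) with degree? p
  ... | inj₂ (d , p≉0 , z) = inj₂ (suc d , p≉0 , λ { (suc i) (ℕ.s≤s d<i) → z i d<i })
  ... | inj₁ p≈0 with x ≟ 0#
  ...   | yes x≈0 = inj₁ (eq λ { zero → x≈0 ; (suc i) → coeff-≈ p≈0 i })
  ...   | no  x≉0 = inj₂ (0 , x≉0 , λ { (suc i) _ → coeff-≈ p≈0 i })

  degree-unique : ∀ {p d e} → HasDegree p d → HasDegree p e → d ≡ e
  degree-unique {d = d} {e} (p≉0 , z) (p≉0′ , z′) with ℕ.<-cmp d e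
  ... | tri< d<e _ _ = ⊥-elim (p≉0′ (z e d<e))
  ... | tri≈ _ d≡e _ = d≡e
  ... | tri> _ _ e<d = ⊥-elim (p≉0 (z′ d e<d))

  HasDegree⇒≉0 : ∀ {p d} → HasDegree p d → ¬ p ≈ₚ 0ₚ
  HasDegree⇒≉0 (p≉0 , _) (eq e) = p≉0 (e _)

  HasDegree? : ∀ p d → Dec (HasDegree p d)
  HasDegree? p d with degree? p
  ... | inj₁ p≈0      = no λ h → HasDegree⇒≉0 h p≈0
  ... | inj₂ (e , h) = map′ (λ { ≡.refl → h }) (degree-unique h) (e ℕ.≟ d)

  0∷ₚ : ∀ {p} → p ≈ₚ 0ₚ → (0# ∷ p) ≈ₚ 0ₚ
  0∷ₚ e = transₚ (∷-cong refl e) 0∷[]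

  degree-· : ∀ {x q n} → x ≉ 0# → HasDegree q n → HasDegree (x · q) n
  degree-· {x} {q} x≉0 (q≉0 , z) =
    (λ e → integral x≉0 q≉0 (trans (sym (coeff-· x q _)) e)) ,
    (λ i n<i → trans (coeff-· x q i) (trans (*-congˡ (z i n<i)) (zeroʳ x)))

  degree-* : ∀ p {q m n} → HasDegree p m → HasDegree q n → HasDegree (p *ₚ q) (m ℕ.+ n)
  degree-* []      (p≉0 , _) _ = ⊥-elim (p≉0 refl)
  degree-* (x ∷ p) {q} {zero}  (x≉0 , z) hq = HasDegree-cong (symₚ (begin
    x · q +ₚ (0# ∷ p *ₚ q)  ≈⟨ +ₚ-cong (reflₚ {x · q}) (0∷ₚ (*ₚ-cong {p} p≈0 (reflₚ {q}))) ⟩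
    x · q +ₚ 0ₚ             ≈⟨ +ₚ-identityʳ (x · q) ⟩
    x · q                   ∎)) (degree-· x≉0 hq)
    where
    open SetoidReasoning setoidₚ
    p≈0 : p ≈ₚ 0ₚ
    p≈0 = eq λ i → z (suc i) ℕ.z<s
  degree-* (x ∷ p) {q} {suc m} {n} (p≉0 , z) hq@(_ , zq) =
    (λ e → leading≉0 h (trans (sym (shift (m ℕ.+ n) (ℕ.m≤n+m n m))) e)) ,
    (λ { (suc i) (ℕ.s≤s m+n<i) →
         trans (shift i (ℕ.≤-trans (ℕ.m≤n+m n m) (ℕ.<⇒≤ m+n<i))) (above≈0 h i m+n<i) })
    where
    h = degree-* p (p≉0 , λ i m<i → z (suc i) (ℕ.s<s m<i)) hq
    shift : ∀ i → n ℕ.≤ i → coeff ((x ∷ p) *ₚ q) (suc i) ≈ coeff (p *ₚ q) i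
    shift i n≤i = begin
      coeff (x · q +ₚ (0# ∷ p *ₚ q)) (suc i)     ≈⟨ coeff-+ (x · q) _ (suc i) ⟩
      coeff (x · q) (suc i) + coeff (p *ₚ q) i   ≈⟨ +-congʳ (coeff-· x q (suc i)) ⟩
      x * coeff q (suc i) + coeff (p *ₚ q) i     ≈⟨ +-congʳ (*-congˡ (zq (suc i) (ℕ.s≤s n≤i))) ⟩
      x * 0# + coeff (p *ₚ q) i                  ≈⟨ +-congʳ (zeroʳ x) ⟩
      0# + coeff (p *ₚ q) i                      ≈⟨ +-identityˡ _ ⟩
      coeff (p *ₚ q) i                           ∎
      where open SetoidReasoning setoid

  *ₚ-cancelʳ : ∀ p q {r d} → HasDegree r d → p *ₚ r ≈ₚ q *ₚ r → p ≈ₚ q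
  *ₚ-cancelʳ p q {r} hr e with degree? (p +ₚ -ₚ q)
  ... | inj₁ p-q≈0   = PR.x∙y⁻¹≈ε⇒x≈y p q p-q≈0
  ... | inj₂ (d , h) = ⊥-elim (HasDegree⇒≉0 (degree-* (p +ₚ -ₚ q) h hr) (begin
    (p +ₚ -ₚ q) *ₚ r           ≈⟨ *ₚ-distribʳ r p (-ₚ q) ⟩
    p *ₚ r +ₚ (-ₚ q) *ₚ r      ≈⟨ +ₚ-cong e (symₚ (PR.-‿distribˡ-* q r)) ⟩
    q *ₚ r +ₚ -ₚ (q *ₚ r)      ≈⟨ -ₚ-inverseʳ (q *ₚ r) ⟩
    0ₚ                         ∎))
    where open SetoidReasoning setoidₚ

  PRFₛ : ℕ → ℕ → Setoid (c ⊔ ℓ) ℓ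
  PRFₛ v u = record
    { Carrier       = PRF v u
    ; _≈_           = _≈ᶠ_
    ; isEquivalence = record
      { refl  = reflₚ
      ; sym   = symₚ
      ; trans = λ {f} {g} {h} → transᶠ f g h
      }
    }
    where
    open SetoidReasoning setoidₚ
    transᶠ : ∀ (f g h : PRF v u) → f ≈ᶠ g → g ≈ᶠ h → f ≈ᶠ h
    transᶠ f g h f≈g g≈h = *ₚ-cancelʳ _ _ (degreeᵈ g) (begin
      (numerator f *ₚ denominator h) *ₚ denominator g ≈⟨ *ₚ.xy∙z≈xz∙y (numerator f) _ _ ⟩
      (numerator f *ₚ denominator g) *ₚ denominator h ≈⟨ *ₚ-cong f≈g (reflₚ {denominator h}) ⟩
      (numerator g *ₚ denominator f) *ₚ denominator h ≈⟨ *ₚ.xy∙z≈xz∙y (numerator g) _ _ ⟩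
      (numerator g *ₚ denominator h) *ₚ denominator f ≈⟨ *ₚ-cong g≈h (reflₚ {denominator f}) ⟩
      (numerator h *ₚ denominator g) *ₚ denominator f ≈⟨ *ₚ.xy∙z≈xz∙y (numerator h) _ _ ⟩
      (numerator h *ₚ denominator f) *ₚ denominator g ∎)

  elements : List Carrier
  elements = proj₁ (F.enumeration hasCardinality)

  elements-complete : IsEnumeration setoid elements
  elements-complete = proj₂ (F.enumeration hasCardinality)

  _≟ₚ_ : Decidable _≈ₚ_
  p ≟ₚ q with degree? (p +ₚ -ₚ q)
  ... | inj₁ p-q≈0   = yes (PR.x∙y⁻¹≈ε⇒x≈y p q p-q≈0)
  ... | inj₂ (d , h) = no λ p≈q →
    HasDegree⇒≉0 h (transₚ (+ₚ-cong p≈q (reflₚ { -ₚ q})) (-ₚ-inverseʳ q))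

  polys : ℕ → List Poly
  polys zero    = [] ∷ []
  polys (suc n) = cartesianProductWith _∷_ elements (polys n)

  polys-complete : ∀ n {p} → (∀ i → n ℕ.≤ i → coeff p i ≈ 0#) → Any (p ≈ₚ_) (polys n)
  polys-complete zero    z = here (eq λ i → z i ℕ.z≤n)
  polys-complete (suc n) {p} z =
    Any.cartesianProductWith⁺ _∷_ (λ x≈ p≈ → transₚ split (∷-cong x≈ p≈))
      (elements-complete (coeff p 0))
      (polys-complete n (λ i n≤i → trans (sym (coeff-≈ split (suc i))) (z (suc i) (ℕ.s≤s n≤i))))
    where
    split : p ≈ₚ (coeff p 0 ∷ drop 1 p)
    split = go p
      where
      go : ∀ p → p ≈ₚ (coeff p 0 ∷ drop 1 p)
      go []      = symₚ 0∷[]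
      go (_ ∷ _) = reflₚ

  factor-bound : ∀ {p q r d} → HasDegree r d → p *ₚ q ≈ₚ r →
                 ∀ i → d ℕ.< i → coeff p i ≈ 0#
  factor-bound {p} {q} hr e i d<i with degree? p | degree? q
  ... | inj₁ p≈0 | _ = coeff-≈ p≈0 i
  ... | inj₂ _   | inj₁ q≈0 =
    ⊥-elim (HasDegree⇒≉0 hr (transₚ (symₚ e) (transₚ (*ₚ-congˡ p q≈0) (*ₚ-zeroʳ p))))
  ... | inj₂ (m , hp) | inj₂ (n , hq)
    with ≡.refl ← degree-unique (HasDegree-cong e (degree-* p hp hq)) hr
    = above≈0 hp i (ℕ.≤-<-trans (ℕ.m≤m+n m n) d<i)

  ∣-bound : ∀ {p r d} → HasDegree r d → p ∣ₚ r → ∀ i → d ℕ.< i → coeff p i ≈ 0#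
  ∣-bound {p} hr (q , e) = factor-bound {p} {q} hr (transₚ (*ₚ-comm p q) e)

  ∣ₚ? : ∀ {r d} → HasDegree r d → ∀ p → Dec (p ∣ₚ r)
  ∣ₚ? {r} {d} hr p = map′
    (λ found → proj₁ (Any.satisfied found) , proj₂ (Any.satisfied found))
    (λ (q , e) → Any.map (λ {q′} q≈q′ → transₚ (*ₚ-cong {q′} {q} (symₚ q≈q′) (reflₚ {p})) e)
                         (polys-complete (suc d) (factor-bound {q} {p} hr e)))
    (Any.any? (λ q → (q *ₚ p) ≟ₚ r) (polys (suc d)))

  Coprimeₚ? : ∀ {p r d e} → HasDegree p d → HasDegree r e → Dec (Coprimeₚ p r)
  Coprimeₚ? {p} {r} {d} hp hr = map′
    (λ all {z} z∣p z∣r → All.lookupWith {R = λ _ → z ∣ₚ 1ₚ}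
      (λ f z≈z′ → ∣ₚ-respˡ (symₚ z≈z′) (f (∣ₚ-respˡ z≈z′ z∣p) (∣ₚ-respˡ z≈z′ z∣r)))
      all (polys-complete (suc d) (∣-bound hp z∣p)))
    (λ coprime → All.universal (λ z → coprime) (polys (suc d)))
    (All.all? (λ z → ∣ₚ? hp z →-dec ∣ₚ? hr z →-dec ∣ₚ? 1-degree z) (polys (suc d)))
    where
    1-degree : HasDegree 1ₚ 0
    1-degree = 1≉0 , λ { (suc i) _ → refl }

  ÷-cong : ∀ {x x′ y y′} → x ≈ x′ → y ≈ y′ → x ÷ y ≈¹ x′ ÷ y′
  ÷-cong {x} {x′} {y} {y′} x≈x′ y≈y′ with y ≟ 0# | y′ ≟ 0#
  ... | yes _   | yes _    = Maybe.nothing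
  ... | yes y≈0 | no y′≉0  = ⊥-elim (y′≉0 (trans (sym y≈y′) y≈0))
  ... | no y≉0  | yes y′≈0 = ⊥-elim (y≉0 (trans y≈y′ y′≈0))
  ... | no y≉0  | no y′≉0  = Maybe.just (*-cong x≈x′ (begin
    r              ≈⟨ *-identityʳ r ⟨
    r * 1#         ≈⟨ *-congˡ (proj₂ (proj₂ (≉0⇒invertible y′≉0))) ⟨
    r * (y′ * r′)  ≈⟨ *-assoc r y′ r′ ⟨
    r * y′ * r′    ≈⟨ *-congʳ (*-congˡ y≈y′) ⟨
    r * y * r′     ≈⟨ *-congʳ (proj₁ (proj₂ (≉0⇒invertible y≉0))) ⟩
    1# * r′        ≈⟨ *-identityˡ r′ ⟩
    r′             ∎))
    where
    open SetoidReasoning setoid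
    r  = proj₁ (≉0⇒invertible y≉0)
    r′ = proj₁ (≉0⇒invertible y′≉0)

  private module P¹ = Setoid P¹

  value-cong : ∀ {v u V V′ U U′ x y} → V ≈ₚ V′ → U ≈ₚ U′ → x ≈¹ y →
               value v u V U x ≈¹ value v u V′ U′ y
  value-cong e f (Maybe.just x≈y) = ÷-cong (eval-cong e x≈y) (eval-cong f x≈y)
  value-cong {v} {u} e f Maybe.nothing with ℕ.<-cmp v u
  ... | tri< _ _ _ = P¹.refl
  ... | tri≈ _ _ _ = ÷-cong (coeff-≈ e v) (coeff-≈ f u)
  ... | tri> _ _ _ = P¹.refl

  P¹-finite : ∃ (IsEnumeration P¹)
  P¹-finite = ∞ ∷ map just elements , λ
    { ∞        → here Maybe.nothing
    ; (just x) → there (Any.map⁺ (Any.map Maybe.just (elements-complete x)))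
    }

  permutes? : ∀ v u V U → Dec (Bijective _≈¹_ _≈¹_ (value v u V U))
  permutes? v u V U = map′
    (λ (inj , surj) → (λ {x} {y} → inj x y) ,
      λ y → proj₁ (surj y) , λ z≈x → P¹.trans (f-cong z≈x) (proj₂ (surj y)))
    (λ (inj , surj) → (λ x y → inj) , λ y → proj₁ (surj y) , proj₂ (surj y) P¹.refl)
    (injective? ×-dec surjective?)
    where
    f = value v u V U
    f-cong : ∀ {x y} → x ≈¹ y → f x ≈¹ f y
    f-cong = value-cong reflₚ reflₚ
    _≟¹_ : Decidable _≈¹_
    _≟¹_ = Maybe.dec _≟_
    open FiniteSetoid P¹ using (∀?; ∃?)
    ∈P¹ = proj₂ P¹-finite

    injectiveAt? : ∀ x → Dec (∀ y → f x ≈¹ f y → x ≈¹ y)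
    injectiveAt? x = ∀? ∈P¹
      (λ y≈y′ inj fx≈fy′ → P¹.trans (inj (P¹.trans fx≈fy′ (f-cong (P¹.sym y≈y′)))) y≈y′)
      (λ y → (f x ≟¹ f y) →-dec (x ≟¹ y))

    injective? : Dec (∀ x y → f x ≈¹ f y → x ≈¹ y)
    injective? = ∀? ∈P¹
      (λ x≈x′ inj y fx′≈fy → P¹.trans (P¹.sym x≈x′) (inj y (P¹.trans (f-cong x≈x′) fx′≈fy)))
      injectiveAt?

    attained? : ∀ y → Dec (∃ λ x → f x ≈¹ y)
    attained? y = ∃? ∈P¹ (λ x≈x′ fx≈y → P¹.trans (f-cong (P¹.sym x≈x′)) fx≈y) (λ x → f x ≟¹ y)

    surjective? : Dec (∀ y → ∃ λ x → f x ≈¹ y)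
    surjective? = ∀? ∈P¹ (λ y≈y′ (x , fx≈y) → x , P¹.trans fx≈y y≈y′) attained?

  IsPRF-cong : ∀ {v u V V′ U U′} → V ≈ₚ V′ → U ≈ₚ U′ → IsPRF v u V U → IsPRF v u V′ U′
  IsPRF-cong {v} {u} {V} {V′} {U} {U′} e f isPRF = record
    { degreeⁿ  = HasDegree-cong e I.degreeⁿ
    ; degreeᵈ  = HasDegree-cong f I.degreeᵈ
    ; coprime  = Coprimeₚ-cong e f I.coprime
    ; permutes =
        (λ {x} {y} fx≈fy → proj₁ I.permutes (P¹.trans (same x) (P¹.trans fx≈fy (P¹.sym (same y))))) ,
        λ y → let x , h = proj₂ I.permutes y in x , λ {z} z≈x → P¹.trans (P¹.sym (same z)) (h z≈x)
    }
    where
    module I = IsPRF isPRF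
    same : ∀ x → value v u V U x ≈¹ value v u V′ U′ x
    same x = value-cong e f (P¹.refl {x})

  IsPRF? : ∀ v u V U → Dec (IsPRF v u V U)
  IsPRF? v u V U with HasDegree? V v | HasDegree? U u
  ... | no ¬h | _     = no (¬h ∘ IsPRF.degreeⁿ)
  ... | yes _ | no ¬h = no (¬h ∘ IsPRF.degreeᵈ)
  ... | yes h | yes k with Coprimeₚ? h k | permutes? v u V U
  ...   | no ¬co | _       = no λ isPRF → ¬co (IsPRF.coprime isPRF)
  ...   | yes _  | no ¬bij = no (¬bij ∘ IsPRF.permutes)
  ...   | yes co | yes bij =
    yes record { degreeⁿ = h ; degreeᵈ = k ; coprime = co ; permutes = bij }

  module _ (v u : ℕ) where
    private
      collect : List (Poly × Poly) → List (PRF v u)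
      collect []             = []
      collect ((V , U) ∷ ps) with IsPRF? v u V U
      ... | yes isPRF = record { isPRF = isPRF } ∷ collect ps
      ... | no  _     = collect ps

      collect⁺ : ∀ (f : PRF v u) {ps} →
                 Any (λ (V , U) → numerator f ≈ₚ V × denominator f ≈ₚ U) ps →
                 Any (f ≈ᶠ_) (collect ps)
      collect⁺ f {(V , U) ∷ ps} h with IsPRF? v u V U
      collect⁺ f (here (e , k)) | yes _ = here (*ₚ-cong e (symₚ k))
      collect⁺ f (here (e , k)) | no ¬isPRF = ⊥-elim (¬isPRF (IsPRF-cong e k (isPRF f)))
      collect⁺ f (there h)      | yes _ = there (collect⁺ f h)
      collect⁺ f (there h)      | no  _ = collect⁺ f h

    PRF-finite : ∃ (PRFₛ v u HasCardinality_)
    PRF-finite = FiniteSetoid.enumeration⇒finite (PRFₛ v u)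
      (λ f g → (numerator f *ₚ denominator g) ≟ₚ (numerator g *ₚ denominator f))
      (λ f → collect⁺ f (Any.cartesianProduct⁺
        (polys-complete (suc v) (above≈0 (degreeⁿ f)))
        (polys-complete (suc u) (above≈0 (degreeᵈ f)))))

    N : ℕ
    N = proj₁ PRF-finite

    N-cardinality : PRFₛ v u HasCardinality N
    N-cardinality = proj₂ PRF-finite

-- If V/U has deg V = deg U = v and takes the value a ≠ 0 at ∞, then
-- V/U = a + 1/(U/r) with r = V - aU of degree u < v, and r ≠ 0 because V and U
-- are coprime and v > 0. The map y ↦ a + 1/y permutes P¹, so V/U is a PRF
-- exactly when U/r is, and V/U ↦ (a , U/r) is a bijection from P_{v,v} onto
-- (F ∖ 0) × ⋃_{u<v} P_{v,u}.

module Submission where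

import Algebra.Properties.CommutativeSemigroup as CommutativeSemigroupProperties
import Algebra.Properties.Ring as RingProperties
open import Data.Empty using (⊥-elim)
open import Data.Fin.Base as Fin using (Fin; zero; suc; toℕ; fromℕ<; punchIn; punchOut)
open import Data.Fin.Permutation using (↔⇒≡)
import Data.Fin.Properties as Fin
open import Data.List.Base using ([]; _∷_; applyUpTo; map; upTo)
open import Data.Maybe.Base using (just; nothing)
import Data.Maybe.Relation.Binary.Pointwise as Maybe
open import Data.Nat.Base as ℕ using (suc)
open import Data.Nat.ListAction using (sum)
import Data.Nat.Properties as ℕ
open import Data.Product.Base using (∃; ∃₂; Σ; _×_; _,_; proj₁; proj₂)
open import Data.Product.Function.NonDependent.Propositional using (_×-↔_)
open import Data.Sum.Base using (_⊎_; inj₁; inj₂)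
open import Data.Sum.Function.Propositional using (_⊎-↔_)
open import Defs
open import Function.Base using (_∘_; id)
open import Function.Bundles using (Inverse; _↔_; mk↔ₛ′)
open import Function.Construct.Composition using (inverse)
open import Function.Definitions using (Bijective)
open import Function.Properties.Bijection using (Bijection⇒Inverse)
open import Function.Properties.Inverse using (↔-refl; ↔-sym; ↔-trans)
open import Level using (_⊔_)
open import Relation.Binary.Bundles using (Setoid)
open import Relation.Binary.Definitions using (tri<; tri≈; tri>)
open import Relation.Binary.PropositionalEquality as ≡ using (_≡_)
import Relation.Binary.Reasoning.Setoid as SetoidReasoning
open import Relation.Nullary using (¬_; yes; no)

-- Finite sums and cardinalities

Σ-Fin-suc : ∀ {n p} {P : Fin (suc n) → Set p} → Σ (Fin (suc n)) P ↔ (P zero ⊎ Σ (Fin n) (P ∘ suc))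
Σ-Fin-suc = mk↔ₛ′
  (λ { (zero , x) → inj₁ x ; (suc i , x) → inj₂ (i , x) })
  (λ { (inj₁ x) → zero , x ; (inj₂ (i , x)) → suc i , x })
  (λ { (inj₁ _) → ≡.refl ; (inj₂ _) → ≡.refl })
  (λ { (zero , _) → ≡.refl ; (suc _ , _) → ≡.refl })

-- `upTo n` is the case `g = id`; a general `g` is carried along because the inductive step replaces
-- it by `g ∘ suc`.
Fin-sum : ∀ (f g : ℕ.ℕ → ℕ.ℕ) n →
          Fin (sum (map f (applyUpTo g n))) ↔ Σ (Fin n) (λ i → Fin (f (g (toℕ i))))
Fin-sum f g ℕ.zero    = mk↔ₛ′ (λ ()) (λ ()) (λ ()) (λ ())
Fin-sum f g (suc n) =
  ↔-trans Fin.+↔⊎ (↔-trans (↔-refl ⊎-↔ Fin-sum f (g ∘ suc) n) (↔-sym Σ-Fin-suc))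

_∖_ : ∀ {a ℓ} (S : Setoid a ℓ) → Setoid.Carrier S → Setoid (a ⊔ ℓ) ℓ
S ∖ z = record
  { Carrier       = ∃ λ x → ¬ x ≈ z
  ; _≈_           = λ x y → proj₁ x ≈ proj₁ y
  ; isEquivalence = record { refl = refl ; sym = sym ; trans = trans }
  }
  where open Setoid S

-- The enumeration loses the number of `z`: `punchOut` closes the gap that this leaves, and
-- `punchIn` reopens it.
∖-cardinality : ∀ {a ℓ n} {S : Setoid a ℓ} → S HasCardinality n → ∀ z →
                (S ∖ z) HasCardinality (n ℕ.∸ 1)
-- The truncated value of `0 ∸ 1` never arises, since `z` itself is an element.
∖-cardinality {n = ℕ.zero} card z with () ← Inverse.to card z
∖-cardinality {n = suc n} {S} card z = record
  { to        = λ x → punchOut (toz≢ x)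
  ; from      = λ j → from (punchIn (to z) j) , λ e → Fin.punchInᵢ≢i (to z) j
                  (≡.trans (≡.sym (strictlyInverseˡ _)) (to-cong e))
  ; to-cong   = λ {x} {y} e → Fin.punchOut-cong (to z) {i≢j = toz≢ x} {i≢k = toz≢ y} (to-cong e)
  ; from-cong = λ e → from-cong (≡.cong (punchIn (to z)) e)
  ; inverse   = (λ {j} {x} e → ≡.trans
                  (Fin.punchOut-cong (to z) {i≢j = toz≢ x} {i≢k = Fin.punchInᵢ≢i (to z) j ∘ ≡.sym}
                    (≡.trans (to-cong e) (strictlyInverseˡ _)))
                  (Fin.punchOut-punchIn (to z)))
              , (λ {x} e → S.trans
                  (from-cong (≡.trans (≡.cong (punchIn (to z)) e) (Fin.punchIn-punchOut (toz≢ x))))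
                  (strictlyInverseʳ _))
  }
  where
  open Inverse card
  module S = Setoid S
  toz≢ : ((x , _) : Setoid.Carrier (S ∖ z)) → ¬ to z ≡ to x
  toz≢ (x , x≉z) e = x≉z (S.trans (S.sym (strictlyInverseʳ x))
    (S.trans (from-cong (≡.sym e)) (strictlyInverseʳ z)))

module _ {c ℓ q} (F : FiniteField c ℓ q) where
  open FiniteField F
  open RationalFunctions F
  open PRF using (numerator; denominator; isPRF)

  private
    module RP = RingProperties ring
    module +S = CommutativeSemigroupProperties +-commutativeSemigroup
    module *S = CommutativeSemigroupProperties *-commutativeSemigroup
    module P¹ = Setoid P¹

  -- Points of P¹ as quotients of homogeneous coordinates

  *-cancelʳ : ∀ {x y z} → z ≉ 0# → x * z ≈ y * z → x ≈ y
  *-cancelʳ {x} {y} {z} z≉0 xz≈yz with x - y ≟ 0#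
  ... | yes x-y≈0 = RP.x∙y⁻¹≈ε⇒x≈y x y x-y≈0
  ... | no  x-y≉0 = ⊥-elim (integral x-y≉0 z≉0 (begin
    (x - y) * z     ≈⟨ RP.[y-z]x≈yx-zx z x y ⟩
    x * z - y * z   ≈⟨ RP.x≈y⇒x∙y⁻¹≈ε xz≈yz ⟩
    0#              ∎))
    where open SetoidReasoning setoid

  -- Equal values are both ∞ or both finite. In the first case both products vanish; in the second
  -- the equation is multiplied by `t * t′`.
  ÷-≈⇒cross : ∀ {s t s′ t′} → s ÷ t ≈¹ s′ ÷ t′ → s * t′ ≈ s′ * t
  ÷-≈⇒cross {s} {t} {s′} {t′} e with t ≟ 0# | t′ ≟ 0#
  ÷-≈⇒cross {s} {t} {s′} {t′} e | yes t≈0 | yes t′≈0 =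
    trans (*-congˡ t′≈0) (trans (zeroʳ s) (sym (trans (*-congˡ t≈0) (zeroʳ s′))))
  ÷-≈⇒cross {s} {t} {s′} {t′} (Maybe.just e) | no t≉0 | no t′≉0 = begin
    s * t′                ≈⟨ *-congˡ (*-identityˡ t′) ⟨
    s * (1# * t′)         ≈⟨ *-congˡ (*-congʳ (proj₁ (proj₂ (≉0⇒invertible t≉0)))) ⟨
    s * (r * t * t′)      ≈⟨ *-congˡ (*-assoc r t t′) ⟩
    s * (r * (t * t′))    ≈⟨ *-assoc s r _ ⟨
    s * r * (t * t′)      ≈⟨ *-congʳ e ⟩
    s′ * r′ * (t * t′)    ≈⟨ *-assoc s′ r′ _ ⟩
    s′ * (r′ * (t * t′))  ≈⟨ *-congˡ (*S.x∙yz≈y∙xz r′ t t′) ⟩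
    s′ * (t * (r′ * t′))  ≈⟨ *-congˡ (*-congˡ (proj₁ (proj₂ (≉0⇒invertible t′≉0)))) ⟩
    s′ * (t * 1#)         ≈⟨ *-congˡ (*-identityʳ t) ⟩
    s′ * t                ∎
    where
    open SetoidReasoning setoid
    r  = proj₁ (≉0⇒invertible t≉0)
    r′ = proj₁ (≉0⇒invertible t′≉0)

  -- These are the homogeneous coordinates of points of P¹. The pair (0, 0) solves every
  -- cross-multiplied equation while its quotient is `∞`, so `cross⇒÷-≈` has to exclude it.
  NonZeroPair : Carrier → Carrier → Set ℓ
  NonZeroPair s t = ¬ (s ≈ 0# × t ≈ 0#)

  cross⇒÷-≈ : ∀ {s t s′ t′} → NonZeroPair s t → NonZeroPair s′ t′ →
              s * t′ ≈ s′ * t → s ÷ t ≈¹ s′ ÷ t′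
  cross⇒÷-≈ {s} {t} {s′} {t′} st≉0 s′t′≉0 e with t ≟ 0# | t′ ≟ 0#
  ... | yes _   | yes _    = Maybe.nothing
  ... | yes t≈0 | no t′≉0  = ⊥-elim (st≉0 (s≈0 , t≈0))
    where
    s≈0 = *-cancelʳ t′≉0 (trans e (trans (*-congˡ t≈0) (trans (zeroʳ s′) (sym (zeroˡ t′)))))
  ... | no t≉0  | yes t′≈0 = ⊥-elim (s′t′≉0 (s′≈0 , t′≈0))
    where
    s′≈0 = *-cancelʳ t≉0 (trans (sym e) (trans (*-congˡ t′≈0) (trans (zeroʳ s) (sym (zeroˡ t)))))
  ... | no t≉0  | no t′≉0  = Maybe.just (*-cancelʳ (integral t≉0 t′≉0) (begin
    s * r * (t * t′)     ≈⟨ *S.interchange s r t t′ ⟩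
    s * t * (r * t′)     ≈⟨ *S.xy∙z≈xz∙y s t _ ⟩
    s * (r * t′) * t     ≈⟨ *-congʳ (*S.x∙yz≈xz∙y s r t′) ⟩
    s * t′ * r * t       ≈⟨ *-assoc _ r t ⟩
    s * t′ * (r * t)     ≈⟨ *-cong e (proj₁ (proj₂ (≉0⇒invertible t≉0))) ⟩
    s′ * t * 1#          ≈⟨ *-congˡ (proj₁ (proj₂ (≉0⇒invertible t′≉0))) ⟨
    s′ * t * (r′ * t′)   ≈⟨ *S.interchange s′ t r′ t′ ⟩
    s′ * r′ * (t * t′)   ∎))
    where
    open SetoidReasoning setoid
    r  = proj₁ (≉0⇒invertible t≉0)
    r′ = proj₁ (≉0⇒invertible t′≉0)

  ÷0 : ∀ {s t} → t ≈ 0# → s ÷ t ≈¹ ∞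
  ÷0 {s} {t} t≈0 with t ≟ 0#
  ... | yes _  = Maybe.nothing
  ... | no t≉0 = ⊥-elim (t≉0 t≈0)

  homogeneous : ∀ y → ∃₂ λ s t → NonZeroPair s t × y ≈¹ s ÷ t
  homogeneous ∞        = 1# , 0# , (1≉0 ∘ proj₁) , P¹.sym (÷0 refl)
  homogeneous (just y) = y , 1# , (1≉0 ∘ proj₂) , y≈y÷1
    where
    y≈y÷1 : just y ≈¹ y ÷ 1#
    y≈y÷1 with 1# ≟ 0#
    ... | yes 1≈0 = ⊥-elim (1≉0 1≈0)
    ... | no 1≉0′ = Maybe.just (sym (trans
      (*-congˡ (trans (sym (*-identityʳ _)) (proj₁ (proj₂ (≉0⇒invertible 1≉0′)))))
      (*-identityʳ y)))

  -- The transformation y ↦ a + 1/y of P¹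

  -- f = a + 1/g, in homogeneous coordinates so that ∞ needs no separate treatment.
  ShiftedReciprocal : Carrier → (f g : ℙ¹ → ℙ¹) → Set _
  ShiftedReciprocal a f g =
    ∀ x → ∃₂ λ s t → NonZeroPair s t × f x ≈¹ (a * s + t) ÷ s × g x ≈¹ s ÷ t

  -- In coordinates, y ↦ a + 1/y is the linear map (s, t) ↦ (as + t, s) of determinant -1, so its
  -- kernel is trivial.
  shift-nonZero : ∀ a {s t} → NonZeroPair s t → NonZeroPair (a * s + t) s
  shift-nonZero a {s} {t} st≉0 (as+t≈0 , s≈0) = st≉0 (s≈0 , (begin
    t           ≈⟨ +-identityˡ t ⟨
    0# + t      ≈⟨ +-congʳ (trans (*-congˡ s≈0) (zeroʳ a)) ⟨
    a * s + t   ≈⟨ as+t≈0 ⟩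
    0#          ∎))
    where open SetoidReasoning setoid

  -- Both sides of the conclusion expand with the common term `a * s * s′`, and what remains is the
  -- hypothesis. `cross-unshift` cancels the same term.
  cross-shift : ∀ a s t s′ t′ → t * s′ ≈ t′ * s → (a * s + t) * s′ ≈ (a * s′ + t′) * s
  cross-shift a s t s′ t′ e = begin
    (a * s + t) * s′         ≈⟨ distribʳ s′ _ _ ⟩
    a * s * s′ + t * s′      ≈⟨ +-cong (*S.xy∙z≈xz∙y a s s′) e ⟩
    a * s′ * s + t′ * s      ≈⟨ distribʳ s _ _ ⟨
    (a * s′ + t′) * s        ∎
    where open SetoidReasoning setoid

  cross-unshift : ∀ a s t s′ t′ → (a * s + t) * s′ ≈ (a * s′ + t′) * s → t * s′ ≈ t′ * s
  cross-unshift a s t s′ t′ e = RP.+-cancelˡ (a * s * s′) _ _ (begin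
    a * s * s′ + t * s′      ≈⟨ distribʳ s′ _ _ ⟨
    (a * s + t) * s′         ≈⟨ e ⟩
    (a * s′ + t′) * s        ≈⟨ distribʳ s _ _ ⟩
    a * s′ * s + t′ * s      ≈⟨ +-congʳ (*S.xy∙z≈xz∙y a s′ s) ⟩
    a * s * s′ + t′ * s      ∎)
    where open SetoidReasoning setoid

  swap-sides : ∀ {s t s′ t′} → s * t′ ≈ s′ * t → t * s′ ≈ t′ * s
  swap-sides e = trans (*-comm _ _) (trans (sym e) (*-comm _ _))

  shift-cancel : ∀ a s t → a * t + (s - a * t) ≈ s
  shift-cancel a s t = trans (+-congˡ (+-comm _ _))
    (trans (sym (+-assoc _ _ _)) (trans (+-congʳ (-‿inverseʳ _)) (+-identityˡ s)))

  module _ {a f g} (rel : ShiftedReciprocal a f g) where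
    -- Together with `unshift-≈` this says that `f` and `g` have the same fibres, which transfers
    -- injectivity in both directions.
    shift-≈ : ∀ x y → g x ≈¹ g y → f x ≈¹ f y
    shift-≈ x y gx≈gy with rel x | rel y
    ... | s , t , st≉0 , fx , gx | s′ , t′ , s′t′≉0 , fy , gy =
      P¹.trans fx (P¹.trans (cross⇒÷-≈ (shift-nonZero a st≉0) (shift-nonZero a s′t′≉0)
        (cross-shift a s t s′ t′ (swap-sides (÷-≈⇒cross (P¹.trans (P¹.sym gx) (P¹.trans gx≈gy gy))))))
        (P¹.sym fy))

    unshift-≈ : ∀ x y → f x ≈¹ f y → g x ≈¹ g y
    unshift-≈ x y fx≈fy with rel x | rel y
    ... | s , t , st≉0 , fx , gx | s′ , t′ , s′t′≉0 , fy , gy =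
      P¹.trans gx (P¹.trans (cross⇒÷-≈ st≉0 s′t′≉0
        (swap-sides (cross-unshift a s t s′ t′ (÷-≈⇒cross (P¹.trans (P¹.sym fx) (P¹.trans fx≈fy fy))))))
        (P¹.sym gy))

    shift-bijective : Bijective _≈¹_ _≈¹_ g → Bijective _≈¹_ _≈¹_ f
    shift-bijective (inj , surj) = (λ {x} {y} → inj ∘ unshift-≈ x y) , λ y →
      let s , t , st≉0 , y≈ = homogeneous y
          -- The value asked of `g` is 1/(y - a), the solution of y = a + 1/g.
          x , gx≈ = surj (t ÷ (s - a * t))
      in x , λ {z} z≈x → attained s t st≉0 y≈ z (gx≈ z≈x)
      where
      attained : ∀ {y} s t → NonZeroPair s t → y ≈¹ s ÷ t →
                 ∀ z → g z ≈¹ t ÷ (s - a * t) → f z ≈¹ y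
      attained {y} s t st≉0 y≈ z gz≈ with rel z
      ... | s′ , t′ , s′t′≉0 , fz , gz =
        P¹.trans fz (P¹.trans (cross⇒÷-≈ (shift-nonZero a s′t′≉0) st≉0 (begin
          (a * s′ + t′) * t                ≈⟨ cross-shift a s′ t′ t _
                                                (swap-sides (÷-≈⇒cross (P¹.trans (P¹.sym gz) gz≈))) ⟩
          (a * t + (s - a * t)) * s′       ≈⟨ *-congʳ (shift-cancel a s t) ⟩
          s * s′                           ∎)) (P¹.sym y≈))
        where open SetoidReasoning setoid

    unshift-bijective : Bijective _≈¹_ _≈¹_ f → Bijective _≈¹_ _≈¹_ g
    unshift-bijective (inj , surj) = (λ {x} {y} → inj ∘ shift-≈ x y) , λ y →
      let s , t , st≉0 , y≈ = homogeneous y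
          -- The value asked of `f` is a + 1/y.
          x , fx≈ = surj ((a * s + t) ÷ s)
      in x , λ {z} z≈x → attained s t st≉0 y≈ z (fx≈ z≈x)
      where
      attained : ∀ {y} s t → NonZeroPair s t → y ≈¹ s ÷ t →
                 ∀ z → f z ≈¹ (a * s + t) ÷ s → g z ≈¹ y
      attained {y} s t st≉0 y≈ z fz≈ with rel z
      ... | s′ , t′ , s′t′≉0 , fz , gz =
        P¹.trans gz (P¹.trans (cross⇒÷-≈ s′t′≉0 st≉0
          (swap-sides (cross-unshift a s′ t′ s t (÷-≈⇒cross (P¹.trans (P¹.sym fz) fz≈)))))
          (P¹.sym y≈))

  -- Evaluation, roots and coprimality

  eval-+ : ∀ p r x → eval (p +ₚ r) x ≈ eval p x + eval r x
  eval-+ []      r       x = sym (+-identityˡ _)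
  eval-+ (y ∷ p) []      x = sym (+-identityʳ _)
  eval-+ (y ∷ p) (z ∷ r) x = begin
    y + z + x * eval (p +ₚ r) x              ≈⟨ +-congˡ (*-congˡ (eval-+ p r x)) ⟩
    y + z + x * (eval p x + eval r x)        ≈⟨ +-congˡ (distribˡ x _ _) ⟩
    y + z + (x * eval p x + x * eval r x)    ≈⟨ +S.interchange y z _ _ ⟩
    y + x * eval p x + (z + x * eval r x)    ∎
    where open SetoidReasoning setoid

  eval-· : ∀ a p x → eval (a · p) x ≈ a * eval p x
  eval-· a []      x = sym (zeroʳ a)
  eval-· a (y ∷ p) x = begin
    a * y + x * eval (a · p) x      ≈⟨ +-congˡ (*-congˡ (eval-· a p x)) ⟩
    a * y + x * (a * eval p x)      ≈⟨ +-congˡ (*S.x∙yz≈y∙xz x a _) ⟩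
    a * y + a * (x * eval p x)      ≈⟨ distribˡ a _ _ ⟨
    a * (y + x * eval p x)          ∎
    where open SetoidReasoning setoid

  linear : Carrier → Poly
  linear x = - x ∷ 1# ∷ []

  linear-degree : ∀ x → HasDegree (linear x) 1
  linear-degree x = 1≉0 , λ { (suc (suc i)) _ → refl ; (suc ℕ.zero) (ℕ.s≤s ()) }

  -- Synthetic division by X - x: the coefficients of the quotient are the intermediate results of
  -- Horner's rule, the values at `x` of the proper tails.
  hornerQuotient : Carrier → Poly → Poly
  hornerQuotient x []      = []
  hornerQuotient x (y ∷ p) = eval p x ∷ hornerQuotient x p

  -- This compares constant coefficients in the inductive step of `horner`, in the shape to which
  -- the product unfolds; `e` is the value of the tail at `x`.
  horner-constant : ∀ x y e → e * - x + 0# + (y + x * e) ≈ y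
  horner-constant x y e = begin
    e * - x + 0# + (y + x * e)   ≈⟨ +-cong (+-identityʳ _) (+-congˡ (*-comm x e)) ⟩
    e * - x + (y + e * x)        ≈⟨ +S.x∙yz≈y∙xz _ y _ ⟩
    y + (e * - x + e * x)        ≈⟨ +-congˡ (distribˡ e _ _) ⟨
    y + e * (- x + x)            ≈⟨ +-congˡ (*-congˡ (-‿inverseˡ x)) ⟩
    y + e * 0#                   ≈⟨ +-congˡ (zeroʳ e) ⟩
    y + 0#                       ≈⟨ +-identityʳ y ⟩
    y                            ∎
    where open SetoidReasoning setoid

  horner : ∀ x p → hornerQuotient x p *ₚ linear x +ₚ (eval p x ∷ []) ≈ₚ p
  horner x []      = 0∷[]
  -- In the higher coefficients, `e * 1#` becomes the remainder of the tail, and the induction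
  -- hypothesis applies.
  horner x (y ∷ p) = ∷-cong (horner-constant x y e) (begin
    ((e * 1# ∷ []) +ₚ hornerQuotient x p *ₚ linear x) +ₚ []
      ≈⟨ +ₚ-identityʳ _ ⟩
    (e * 1# ∷ []) +ₚ hornerQuotient x p *ₚ linear x
      ≈⟨ +ₚ-comm (e * 1# ∷ []) _ ⟩
    hornerQuotient x p *ₚ linear x +ₚ (e * 1# ∷ [])
      ≈⟨ +ₚ-cong (reflₚ {hornerQuotient x p *ₚ linear x}) (∷-cong (*-identityʳ e) reflₚ) ⟩
    hornerQuotient x p *ₚ linear x +ₚ (e ∷ [])
      ≈⟨ horner x p ⟩
    p ∎)
    where
    open SetoidReasoning setoidₚ
    e = eval p x

  root⇒linear-∣ : ∀ x p → eval p x ≈ 0# → linear x ∣ₚ p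
  root⇒linear-∣ x p e = hornerQuotient x p , (begin
    hornerQuotient x p *ₚ linear x                      ≈⟨ +ₚ-identityʳ _ ⟨
    hornerQuotient x p *ₚ linear x +ₚ 0ₚ
      ≈⟨ +ₚ-cong (reflₚ {hornerQuotient x p *ₚ linear x}) (transₚ (∷-cong e reflₚ) 0∷[]) ⟨
    hornerQuotient x p *ₚ linear x +ₚ (eval p x ∷ [])   ≈⟨ horner x p ⟩
    p                                                   ∎)
    where open SetoidReasoning setoidₚ

  -- Degrees add in a product. Contradictions to coprimality are drawn from this: a common linear
  -- factor, or a zero remainder in `IsPRF-unshift`.
  ∣1⇒degree-0 : ∀ {p d} → HasDegree p d → p ∣ₚ 1ₚ → d ≡ 0
  ∣1⇒degree-0 {p} hp (k , kp≈1) with degree? k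
  ... | inj₁ k≈0      = ⊥-elim (1≉0 (coeff-≈ (transₚ (symₚ kp≈1) (*ₚ-cong {k} {0ₚ} k≈0 (reflₚ {p}))) 0))
  ... | inj₂ (e , hk) = ℕ.m+n≡0⇒n≡0 e (degree-unique (degree-* k hk hp)
    (HasDegree-cong (symₚ kp≈1) (1≉0 , λ { (suc i) _ → refl })))

  coprime⇒no-common-root : ∀ {V U} → Coprimeₚ V U → ∀ x → NonZeroPair (eval V x) (eval U x)
  coprime⇒no-common-root {V} {U} coprime x (Vx≈0 , Ux≈0)
    with () ← ∣1⇒degree-0 (linear-degree x)
                (coprime (root⇒linear-∣ x V Vx≈0) (root⇒linear-∣ x U Ux≈0))

  -- The shift V = aU + r and its effect on PRFs

  coeff-shift : ∀ a U r {V} → V ≈ₚ a · U +ₚ r → ∀ i → coeff V i ≈ a * coeff U i + coeff r i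
  coeff-shift a U r e i =
    trans (coeff-≈ e i) (trans (coeff-+ (a · U) r i) (+-congʳ (coeff-· a U i)))

  -- Solving for the remainder is a shift by `- a`, so that each lemma on shifts also serves the
  -- inverse direction.
  shift-transpose : ∀ a U r {V} → V ≈ₚ a · U +ₚ r → r ≈ₚ (- a) · U +ₚ V
  shift-transpose a U r {V} e = eq λ i → begin
    coeff r i                                                ≈⟨ +-identityˡ _ ⟨
    0# + coeff r i
      ≈⟨ +-congʳ (trans (*-congʳ (-‿inverseˡ a)) (zeroˡ _)) ⟨
    (- a + a) * coeff U i + coeff r i                        ≈⟨ +-congʳ (distribʳ _ (- a) a) ⟩
    - a * coeff U i + a * coeff U i + coeff r i              ≈⟨ +-assoc _ _ _ ⟩
    - a * coeff U i + (a * coeff U i + coeff r i)            ≈⟨ +-congˡ (coeff-shift a U r e i) ⟨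
    - a * coeff U i + coeff V i                              ≈⟨ +-congʳ (coeff-· (- a) U i) ⟨
    coeff ((- a) · U) i + coeff V i                          ≈⟨ coeff-+ ((- a) · U) V i ⟨
    coeff ((- a) · U +ₚ V) i                                 ∎
    where open SetoidReasoning setoid

  -- The Euclidean step: combined with `shift-transpose`, it gives (V, U) and (U, r) the same common
  -- divisors.
  ∣ₚ-shift : ∀ a {U V r z} → V ≈ₚ a · U +ₚ r → z ∣ₚ U → z ∣ₚ r → z ∣ₚ V
  ∣ₚ-shift a {U} {V} {r} {z} e (k , kz≈U) (l , lz≈r) = a · k +ₚ l , (begin
    (a · k +ₚ l) *ₚ z           ≈⟨ *ₚ-distribʳ z (a · k) l ⟩
    (a · k) *ₚ z +ₚ l *ₚ z      ≈⟨ +ₚ-cong (transₚ (·-*ₚ a k z) (·-cong refl kz≈U)) lz≈r ⟩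
    a · U +ₚ r                  ≈⟨ e ⟨
    V                           ∎)
    where open SetoidReasoning setoidₚ

  value-∞-numerator : ∀ {v u V U} → u ℕ.< v → value v u V U ∞ ≈¹ ∞
  value-∞-numerator {v} {u} u<v with ℕ.<-cmp v u
  ... | tri< _ _ u≮v = ⊥-elim (u≮v u<v)
  ... | tri≈ _ _ u≮v = ⊥-elim (u≮v u<v)
  ... | tri> _ _ _   = Maybe.nothing

  value-∞-balanced : ∀ {v V U} → value v v V U ∞ ≈¹ coeff V v ÷ coeff U v
  value-∞-balanced {v} with ℕ.<-cmp v v
  ... | tri< _ v≢v _ = ⊥-elim (v≢v ≡.refl)
  ... | tri≈ _ _ _   = P¹.refl
  ... | tri> _ v≢v _ = ⊥-elim (v≢v ≡.refl)

  -- At a finite point the coordinates are the values of `U` and `r`, not both zero by coprimality.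
  -- At ∞ they are the coefficients of degree `v`, where that of `r` vanishes because `u < v`.
  value-shift : ∀ a {v u U V r} → V ≈ₚ a · U +ₚ r → u ℕ.< v →
                HasDegree U v → HasDegree r u → Coprimeₚ U r →
                ShiftedReciprocal a (value v v V U) (value v u U r)
  value-shift a {v} {u} {U} {V} {r} e u<v U-deg r-deg coprime ∞ =
    coeff U v , 0# , leading≉0 U-deg ∘ proj₁ ,
    P¹.trans (value-∞-balanced {v} {V} {U})
      (÷-cong (trans (coeff-shift a U r e v) (+-congˡ (above≈0 r-deg v u<v))) refl) ,
    P¹.trans (value-∞-numerator {v} {u} {U} {r} u<v) (P¹.sym (÷0 refl))
  value-shift a {v} {u} {U} {V} {r} e u<v U-deg r-deg coprime (just x) =
    eval U x , eval r x , coprime⇒no-common-root {U} {r} coprime x ,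
    ÷-cong (trans (eval-cong {p = V} e refl)
                  (trans (eval-+ (a · U) r x) (+-congʳ (eval-· a U x)))) refl ,
    P¹.refl

  IsPRF-shift : ∀ {a v u U V r} → a ≉ 0# → V ≈ₚ a · U +ₚ r → u ℕ.< v →
                IsPRF v u U r → IsPRF v v V U
  IsPRF-shift {a} {v} {u} {U} {V} {r} a≉0 e u<v isPRF = record
    -- As `r` has degree below `v`, the leading coefficient of `V` is `a` times that of `U`, which
    -- is nonzero.
    { degreeⁿ  =
        (λ Vv≈0 → integral a≉0 (leading≉0 degreeⁿ)
          (trans (sym (+-identityʳ _)) (trans (+-congˡ (sym (above≈0 degreeᵈ v u<v)))
            (trans (sym (coeff-V v)) Vv≈0)))) ,
        (λ i v<i → trans (coeff-V i) (trans
          (+-cong (trans (*-congˡ (above≈0 degreeⁿ i v<i)) (zeroʳ a))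
                  (above≈0 degreeᵈ i (ℕ.<-trans u<v v<i)))
          (+-identityʳ 0#)))
    ; degreeᵈ  = degreeⁿ
    ; coprime  = λ z∣V z∣U → coprime z∣U (∣ₚ-shift (- a) (shift-transpose a U r e) z∣U z∣V)
    ; permutes = shift-bijective (value-shift a e u<v degreeⁿ degreeᵈ coprime) permutes
    }
    where
    open IsPRF isPRF
    coeff-V = coeff-shift a U r e

  -- The pair (a, U/r) attached to V/U. The degree of `r` belongs to the data, since it selects the
  -- set P_{v,u} that contains U/r.
  record Shift (v : ℕ.ℕ) (V U : Poly) : Set (c ⊔ ℓ) where
    field
      value∞          : Carrier
      value∞≉0        : value∞ ≉ 0#
      remainder       : Poly
      degree          : ℕ.ℕ
      degree<         : degree ℕ.< v
      numerator≈      : V ≈ₚ value∞ · U +ₚ remainder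
      remainder-isPRF : IsPRF v degree U remainder

  IsPRF-unshift : ∀ {v V U} → 0 ℕ.< v → IsPRF v v V U → Shift v V U
  IsPRF-unshift {v} {V} {U} 0<v isPRF = shift (degree? r)
    where
    open IsPRF isPRF
    b⁻¹ = proj₁ (≉0⇒invertible (leading≉0 degreeᵈ))
    -- The value of V/U at ∞, which is the constant that makes the terms of degree `v` in V - aU
    -- cancel.
    a = coeff V v * b⁻¹
    r = (- a) · U +ₚ V

    a*b≈ : a * coeff U v ≈ coeff V v
    a*b≈ = trans (*-assoc _ _ _)
      (trans (*-congˡ (proj₁ (proj₂ (≉0⇒invertible (leading≉0 degreeᵈ))))) (*-identityʳ _))

    a≉0 : a ≉ 0#
    a≉0 a≈0 = leading≉0 degreeⁿ (trans (sym a*b≈) (trans (*-congʳ a≈0) (zeroˡ _)))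

    V≈ : V ≈ₚ a · U +ₚ r
    V≈ = transₚ (shift-transpose (- a) U V reflₚ)
                (+ₚ-cong (·-cong (RP.-‿involutive a) (reflₚ {U})) (reflₚ {r}))

    r-coprime : Coprimeₚ U r
    r-coprime z∣U z∣r = coprime (∣ₚ-shift a V≈ z∣U z∣r) z∣U

    coeff-r : ∀ i → coeff r i ≈ - a * coeff U i + coeff V i
    coeff-r = coeff-shift (- a) U V reflₚ

    r-above≈0 : ∀ i → v ℕ.≤ i → coeff r i ≈ 0#
    r-above≈0 i v≤i with ℕ.m≤n⇒m<n∨m≡n v≤i
    ... | inj₁ v<i    = trans (coeff-r i) (trans
      (+-cong (trans (*-congˡ (above≈0 degreeᵈ i v<i)) (zeroʳ _)) (above≈0 degreeⁿ i v<i))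
      (+-identityʳ 0#))
    ... | inj₂ ≡.refl = trans (coeff-r v) (trans
      (+-congʳ (trans (sym (RP.-‿distribˡ-* a _)) (-‿cong a*b≈)))
      (-‿inverseˡ _))

    shift : r ≈ₚ 0ₚ ⊎ ∃ (HasDegree r) → Shift v V U
    -- If `r` were zero, `U` would be a common divisor of `U` and `r`, hence constant, against
    -- `0 < v`.
    shift (inj₁ r≈0) = ⊥-elim (ℕ.<⇒≢ 0<v (≡.sym
      (∣1⇒degree-0 degreeᵈ (r-coprime (1ₚ , *ₚ-identityˡ U) (0ₚ , symₚ r≈0)))))
    shift (inj₂ (d , r-deg)) = record
      { value∞≉0        = a≉0
      ; degree<         = d<v
      ; numerator≈      = V≈
      ; remainder-isPRF = record
        { degreeⁿ  = degreeᵈ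
        ; degreeᵈ  = r-deg
        ; coprime  = r-coprime
        ; permutes = unshift-bijective (value-shift a V≈ d<v degreeᵈ r-deg r-coprime) permutes
        }
      }
      where d<v = ℕ.≰⇒> (leading≉0 r-deg ∘ r-above≈0 d)

  -- Uniqueness of the decomposition

  coeff-shift-* : ∀ a U r S i → coeff ((a · U +ₚ r) *ₚ S) i ≈ a * coeff (U *ₚ S) i + coeff (r *ₚ S) i
  coeff-shift-* a U r S = coeff-shift a (U *ₚ S) (r *ₚ S)
    (transₚ (*ₚ-distribʳ S (a · U) r) (+ₚ-cong (·-*ₚ a U S) (reflₚ {r *ₚ S})))

  -- Subtracting `a` from both fractions leaves r/U on the left and turns the constant `a′` on the
  -- right into `a′ - a`.
  cross-multiply-shift : ∀ a U r a′ U′ r′ → (a · U +ₚ r) *ₚ U′ ≈ₚ (a′ · U′ +ₚ r′) *ₚ U →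
                         r *ₚ U′ ≈ₚ ((a′ - a) · U′ +ₚ r′) *ₚ U
  cross-multiply-shift a U r a′ U′ r′ e = eq λ i →
    RP.+-cancelˡ (a * coeff (U *ₚ U′) i) _ _ (begin
      a * coeff (U *ₚ U′) i + coeff (r *ₚ U′) i
        ≈⟨ coeff-shift-* a U r U′ i ⟨
      coeff ((a · U +ₚ r) *ₚ U′) i
        ≈⟨ coeff-≈ e i ⟩
      coeff ((a′ · U′ +ₚ r′) *ₚ U) i
        ≈⟨ coeff-shift-* a′ U′ r′ U i ⟩
      a′ * coeff (U′ *ₚ U) i + coeff (r′ *ₚ U) i
        ≈⟨ +-congʳ (*-congʳ (trans (sym (+-assoc a a′ (- a))) (RP.xyx⁻¹≈y a a′))) ⟨
      (a + (a′ - a)) * coeff (U′ *ₚ U) i + coeff (r′ *ₚ U) i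
        ≈⟨ +-congʳ (distribʳ _ a (a′ - a)) ⟩
      a * coeff (U′ *ₚ U) i + (a′ - a) * coeff (U′ *ₚ U) i + coeff (r′ *ₚ U) i
        ≈⟨ +-assoc _ _ _ ⟩
      a * coeff (U′ *ₚ U) i + ((a′ - a) * coeff (U′ *ₚ U) i + coeff (r′ *ₚ U) i)
        ≈⟨ +-cong (*-congˡ (coeff-≈ (*ₚ-comm U U′) i)) (coeff-shift-* (a′ - a) U′ r′ U i) ⟨
      a * coeff (U *ₚ U′) i + coeff (((a′ - a) · U′ +ₚ r′) *ₚ U) i ∎)
    where open SetoidReasoning setoid

  shift-cong : ∀ {a a′} U r U′ r′ → a ≈ a′ → U *ₚ r′ ≈ₚ U′ *ₚ r →
               (a · U +ₚ r) *ₚ U′ ≈ₚ (a′ · U′ +ₚ r′) *ₚ U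
  shift-cong {a} {a′} U r U′ r′ a≈a′ e = eq λ i → begin
    coeff ((a · U +ₚ r) *ₚ U′) i                     ≈⟨ coeff-shift-* a U r U′ i ⟩
    a * coeff (U *ₚ U′) i + coeff (r *ₚ U′) i
      ≈⟨ +-cong (*-cong a≈a′ (coeff-≈ (*ₚ-comm U U′) i)) (coeff-≈ rU′≈r′U i) ⟩
    a′ * coeff (U′ *ₚ U) i + coeff (r′ *ₚ U) i       ≈⟨ coeff-shift-* a′ U′ r′ U i ⟨
    coeff ((a′ · U′ +ₚ r′) *ₚ U) i                   ∎
    where
    open SetoidReasoning setoid
    rU′≈r′U = transₚ (*ₚ-comm r U′) (transₚ (symₚ e) (*ₚ-comm U r′))

  -- After `a` is subtracted, the right numerator `s` satisfies r U′ = s U with deg U = deg U′, so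
  -- it is zero or has degree `u < v`. Its coefficient of degree `v` is `a′ - a` times the leading
  -- coefficient of `U′`, which forces a = a′; then `s` is `r′`, and comparing degrees gives u = u′.
  shift-unique : ∀ {v u u′ a a′ U U′ r r′} → u ℕ.< v → u′ ℕ.< v →
                 HasDegree U v → HasDegree U′ v → HasDegree r u → HasDegree r′ u′ →
                 (a · U +ₚ r) *ₚ U′ ≈ₚ (a′ · U′ +ₚ r′) *ₚ U →
                 a ≈ a′ × u ≡ u′ × U *ₚ r′ ≈ₚ U′ *ₚ r
  shift-unique {v} {u} {u′} {a} {a′} {U} {U′} {r} {r′} u<v u′<v U-deg U′-deg r-deg r′-deg e =
    sym (RP.x∙y⁻¹≈ε⇒x≈y a′ a a′-a≈0) ,
    ℕ.+-cancelʳ-≡ v u u′ (degree-unique rU′-deg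
      (HasDegree-cong (symₚ rU′≈r′U) (degree-* r′ r′-deg U-deg))) ,
    transₚ (*ₚ-comm U r′) (transₚ (symₚ rU′≈r′U) (*ₚ-comm r U′))
    where
    s = (a′ - a) · U′ +ₚ r′

    rU′≈sU : r *ₚ U′ ≈ₚ s *ₚ U
    rU′≈sU = cross-multiply-shift a U r a′ U′ r′ e

    rU′-deg : HasDegree (r *ₚ U′) (u ℕ.+ v)
    rU′-deg = degree-* r r-deg U′-deg

    s-coeff-v≈0 : coeff s v ≈ 0#
    s-coeff-v≈0 with degree? s
    ... | inj₁ s≈0         = coeff-≈ s≈0 v
    ... | inj₂ (d , s-deg) = above≈0 s-deg v (≡.subst (ℕ._< v)
      (ℕ.+-cancelʳ-≡ v u d (degree-unique rU′-deg
        (HasDegree-cong (symₚ rU′≈sU) (degree-* s s-deg U-deg)))) u<v)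

    a′-a≈0 : a′ - a ≈ 0#
    a′-a≈0 = *-cancelʳ (leading≉0 U′-deg) (begin
      (a′ - a) * coeff U′ v                  ≈⟨ +-identityʳ _ ⟨
      (a′ - a) * coeff U′ v + 0#             ≈⟨ +-congˡ (above≈0 r′-deg v u′<v) ⟨
      (a′ - a) * coeff U′ v + coeff r′ v     ≈⟨ coeff-shift (a′ - a) U′ r′ reflₚ v ⟨
      coeff s v                              ≈⟨ s-coeff-v≈0 ⟩
      0#                                     ≈⟨ zeroˡ _ ⟨
      0# * coeff U′ v                        ∎)
      where open SetoidReasoning setoid

    rU′≈r′U : r *ₚ U′ ≈ₚ r′ *ₚ U
    rU′≈r′U = transₚ rU′≈sU (*ₚ-cong {s} {r′}
      (+ₚ-cong (transₚ (·-cong a′-a≈0 (reflₚ {U′})) (·-zero U′)) (reflₚ {r′})) (reflₚ {U}))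

  -- The counting bijection

  module _ (v : ℕ.ℕ) where
    private
      -- The triples (a, u, U/r) are recorded by their numbers in the enumerations, so that their
      -- equality is propositional.
      Index : Set
      Index = Fin (q ℕ.∸ 1) × Σ (Fin v) (λ j → Fin (N v (toℕ j)))

      module K = Inverse (∖-cardinality hasCardinality 0#)
      module C (u : ℕ.ℕ) = Inverse (N-cardinality v u)

    shiftedPRF : Index → PRF v v
    shiftedPRF (i , j , k) = record
      -- Here `reflₚ` fixes the omitted numerator as aU + r.
      { isPRF = IsPRF-shift (proj₂ (K.from i)) reflₚ (Fin.toℕ<n j) (isPRF (C.from (toℕ j) k)) }

    shiftedPRF-injective : ∀ x y → shiftedPRF x ≈ᶠ shiftedPRF y → x ≡ y
    shiftedPRF-injective (i , j , k) (i′ , j′ , k′) e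
      with shift-unique (Fin.toℕ<n j) (Fin.toℕ<n j′)
             (PRF.degreeⁿ (C.from (toℕ j) k)) (PRF.degreeⁿ (C.from (toℕ j′) k′))
             (PRF.degreeᵈ (C.from (toℕ j) k)) (PRF.degreeᵈ (C.from (toℕ j′) k′)) e
    ... | a≈a′ , u≡u′ , g≈g′
      -- Identifying `j` with `j′` puts `k` and `k′` into the same set, where they can be compared.
      with ≡.refl ← Fin.toℕ-injective u≡u′
         | ≡.refl ← ≡.trans (≡.sym (K.strictlyInverseˡ i))
                      (≡.trans (K.to-cong {K.from i} {K.from i′} a≈a′) (K.strictlyInverseˡ i′))
      = ≡.cong (λ k → i , j , k) (≡.trans (≡.sym (C.strictlyInverseˡ (toℕ j) k))
          (≡.trans (C.to-cong (toℕ j) g≈g′) (C.strictlyInverseˡ (toℕ j) k′)))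

    shiftedPRF-surjective : 0 ℕ.< v → ∀ f → ∃ λ x → shiftedPRF x ≈ᶠ f
    shiftedPRF-surjective 0<v f =
      attained value∞≉0 (fromℕ< degree<) (Fin.toℕ-fromℕ< degree<) numerator≈ remainder-isPRF
      where
      open Shift (IsPRF-unshift 0<v (isPRF f))
      -- The degree is generalised to a variable `u` so that `toℕ j ≡ u` can be matched with
      -- `≡.refl`.
      attained : ∀ {a u r} → a ≉ 0# → (j : Fin v) → toℕ j ≡ u →
                 numerator f ≈ₚ a · denominator f +ₚ r → IsPRF v u (denominator f) r →
                 ∃ λ x → shiftedPRF x ≈ᶠ f
      attained {a} {_} {r} a≉0 j ≡.refl f≈ r-isPRF = (i , j , k) , transₚ
        (shift-cong (numerator g) (denominator g) (denominator f) r
          (K.strictlyInverseʳ (a , a≉0)) (C.strictlyInverseʳ (toℕ j) h))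
        (*ₚ-cong (symₚ f≈) (reflₚ {numerator g}))
        where
        h : PRF v (toℕ j)
        h = record { isPRF = r-isPRF }
        i = K.to (a , a≉0)
        k = C.to (toℕ j) h
        -- The enumerated representative agrees with `h` only as a fraction, which is why
        -- `shift-cong` enters above.
        g = C.from (toℕ j) k

    shiftedPRF-inverse : 0 ℕ.< v → Inverse (≡.setoid Index) (PRFₛ v v)
    shiftedPRF-inverse 0<v = Bijection⇒Inverse (record
      { to        = shiftedPRF
      ; cong      = λ { {x} ≡.refl → reflₚ {numerator (shiftedPRF x) *ₚ denominator (shiftedPRF x)} }
      ; bijective = (λ {x} {y} → shiftedPRF-injective x y) , λ f →
          let x , e = shiftedPRF-surjective 0<v f in x , λ { ≡.refl → e }
      })

    N-balanced : 0 ℕ.< v → N v v ≡ (q ℕ.∸ 1) ℕ.* sum (map (N v) (upTo v))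
    N-balanced 0<v = ≡.sym (↔⇒≡ (↔-trans Fin.*↔×
      (↔-trans (↔-refl ×-↔ Fin-sum (N v) id v)
               -- This composite passes through fractions up to `_≈ᶠ_`, so it is formed for setoids;
               -- both of its ends carry propositional equality.
               (inverse (shiftedPRF-inverse 0<v) (N-cardinality v v)))))

open import Data.Nat.Base using (ℕ; _*_; _∸_; _<_)

theorem2p3 : ∀ {c ℓ} (q : ℕ) → PrimePower q → (F : FiniteField c ℓ q) →
    let open RationalFunctions F using (N) in
    (v : ℕ) → 1 < v → N v v ≡ (q ∸ 1) * sum (map (λ u → N v u) (upTo v))
theorem2p3 q _ F v 1<v = N-balanced F v (ℕ.<-trans ℕ.z<s 1<v)
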